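{- For every real $\alpha>0$ and every integer $k\geq 3$ there exist $\epsilon>0$ and $n_0$ such that if $G$ is a $k$-uniform hypergraph on $n\geq n_0$ vertices with $e(G)>(1-\epsilon)\binom{n}{k}$, then (1) $\mathrm{mc}_k(G)\geq (1-\alpha)n$, and (2) $\mathrm{mc}_{k+1}(G)\geq \left(\frac{k}{k+1}-\alpha\right)n$.
   Context: A hypergraph $H=(V,E)$ is connected if its shadow graph (vertex set $V$, with $\{x,y\}$ an edge whenever $\{x,y\}\subseteq e$ for some $e\in E$) is connected; a component is a maximal connected subhypergraph, and its order is its number of vertices. For an $r$-coloring $\chi:E(H)\to[r]$ of the edges, a monochromatic component is a component of the subhypergraph formed by the edges of one color; $\mathrm{mc}(H,\chi)$ is the largest order of a monochromatic component, and $\mathrm{mc}_r(H)=\min_{\chi}\mathrm{mc}(H,\chi)$ over all $r$-colorings $\chi$. $e(G)$ denotes the number of edges of $G$. -}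

module Defs where

open import Data.Nat using (ℕ; zero; suc)
open import Data.Bool using (Bool; true; false)
open import Data.Fin using (Fin)
open import Data.Fin.Subset using (Subset; _∈_; ∣_∣)
open import Data.Vec using ([]; _∷_)
open import Data.List using (List; []; _∷_; map; _++_; filterᵇ; length)
open import Data.Product using (∃; Σ; _×_)
open import Data.Integer using (+_)
open import Data.Rational using (ℚ; _/_; _≤_)
open import Relation.Binary.PropositionalEquality using (_≡_)

Hypergraph : ℕ → Set
Hypergraph n = Subset n → Bool

Uniform : ∀ {n} → ℕ → Hypergraph n → Set
Uniform k G = ∀ e → G e ≡ true → ∣ e ∣ ≡ k

allSubsets : (n : ℕ) → List (Subset n)
allSubsets zero = [] ∷ []
allSubsets (suc n) = map (true ∷_) (allSubsets n) ++ map (false ∷_) (allSubsets n)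

edgeCount : ∀ {n} → Hypergraph n → ℕ
edgeCount {n} G = length (filterᵇ G (allSubsets n))

ℕtoℚ : ℕ → ℚ
ℕtoℚ m = (+ m) / 1

-- An r-colouring of the edges (values on non-edges are irrelevant).
Colouring : ℕ → ℕ → Set
Colouring n r = Subset n → Fin r

-- Conn G χ c v w : w lies in the same component as v in the spanning
-- subhypergraph (Fin n, {e ∈ E(G) : χ e = c}), i.e. v and w are joined by a
-- walk in its shadow graph.
data Conn {n r : ℕ} (G : Hypergraph n) (χ : Colouring n r) (c : Fin r) (v : Fin n)
     : Fin n → Set where
  here : Conn G χ c v v
  step : ∀ {u w} → Conn G χ c v u → (e : Subset n) → G e ≡ true → χ e ≡ c →
         u ∈ e → w ∈ e → Conn G χ c v w

-- mc(G, χ) ≥ x : some monochromatic component has order ≥ x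
-- (witnessed by a colour c, a vertex v, and a set S of vertices in v's
-- colour-c component with |S| ≥ x).
MCAtLeastFor : ∀ {n r} → Hypergraph n → Colouring n r → ℚ → Set
MCAtLeastFor {n} {r} G χ x =
  Σ (Fin r) λ c → Σ (Fin n) λ v → Σ (Subset n) λ S →
    (∀ u → u ∈ S → Conn G χ c v u) × (x ≤ ℕtoℚ ∣ S ∣)

MCAtLeast : ∀ {n} → (r : ℕ) → Hypergraph n → ℚ → Set
MCAtLeast {n} r G x = (χ : Colouring n r) → MCAtLeastFor G χ x

{-# OPTIONS --safe #-}
-- Suppose that every monochromatic component is small, and let each colour
-- partition the vertices into its components. A tuple of k vertices that is split
-- by every partition lies in no edge, so there are few such tuples. A pair split by
-- d of the r partitions, d ≥ r - (k - 2), extends to many such tuples: each remaining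
-- partition is split by one more vertex, which avoids a small class. So almost all
-- pairs are split by at most one partition when r = k, and by at most two when
-- r = k + 1. Regard a vertex as the vector of its classes. After discarding a few
-- vertices, boundedly many reference vertices are within Hamming distance 1 (or 2)
-- of all others. Distance 1 forces a constant coordinate, that is, an almost
-- spanning component. Distance 2 with at least four coordinates forces a constant
-- coordinate or a Hamming ball of radius 1; in a ball the deviations from the
-- centre are disjoint for different coordinates, so some coordinate deviates on at
-- most n / (k + 1) vertices.
module Submission where

open import Defs
open import Data.Bool using (Bool; true; false)
import Data.Bool.Properties as Bool
open import Data.Empty using (⊥; ⊥-elim)
open import Data.Fin using (Fin; zero; suc; _≟_)
open import Data.Fin.Properties using (any?; all?; ¬∀⟶∃¬; pigeonhole)
import Data.Fin.Properties as Fin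
import Data.Fin.Subset as Subset
open import Data.Fin.Subset using (Subset; _∈_; _⊆_; _∪_; ⁅_⁆; ∣_∣)
open import Data.Fin.Subset.Properties using (_∈?_; anySubset?; x∈⁅x⁆; ∣p∣≤n; p⊆p∪q; q⊆p∪q; s⊆s; out⊆; ⊆-refl; ∣⊥∣≡0; ∪-identityˡ)
open import Data.Integer using (+_)
import Data.Integer as ℤ
import Data.Integer.Properties as ℤ
import Data.Integer.Tactic.RingSolver as ℤ-Ring
open import Data.List using (List; []; _∷_; _++_; map; length; filter; allFin; cartesianProduct; cartesianProductWith; lookup)
import Data.List.Membership.DecPropositional as DecMembership
open import Data.List.Membership.Propositional using () renaming (_∈_ to _∈ˡ_)
open import Data.List.Membership.Propositional.Properties using (∈-map⁺; ∈-++⁺ˡ; ∈-++⁺ʳ; ∈-allFin; ∈-cartesianProduct⁺; ∈-filter⁺)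
open import Data.List.Properties using (map-tabulate)
open import Data.List.Relation.Unary.All as All using (All; []; _∷_)
open import Data.List.Relation.Unary.AllPairs using ([]; _∷_)
open import Data.List.Relation.Unary.All.Properties using (¬Any⇒All¬)
open import Data.List.Relation.Unary.Any using (here; there; index)
open import Data.List.Relation.Unary.Any.Properties using (lookup-index)
open import Data.List.Relation.Unary.Unique.Propositional using (Unique)
open import Data.Nat using (ℕ; zero; suc; _+_; _^_; _≤_; _≥_; z≤n; s≤s; NonZero; >-nonZero; _≤?_)
import Data.Nat as ℕ
open import Data.Nat.Combinatorics using (_C_; nCk+nC[k+1]≡[n+1]C[k+1]; k>n⇒nCk≡0)
open import Data.Nat.Properties hiding (_≟_; _≤?_)
open import Data.Nat.Tactic.RingSolver using (solve-∀)
open import Data.Product using (Σ; ∃; _×_; _,_; proj₁; proj₂)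
open import Data.Rational using (ℚ; 0ℚ; 1ℚ; _<_; _*_; _-_; _/_)
import Data.Rational as ℚ
import Data.Rational.Properties as ℚ
import Data.Rational.Unnormalised as ℚᵘ
import Data.Rational.Unnormalised.Properties as ℚᵘ
open import Data.Sum using (_⊎_; inj₁; inj₂)
open import Data.Vec using (Vec; []; _∷_; here; there)
import Data.Vec as Vec
open import Data.Vec.Properties using (lookup∘tabulate; []=⇒lookup)
open import Data.Vec.Relation.Unary.All as Allⱽ using ([]; _∷_) renaming (All to Allⱽ)
open import Data.Vec.Relation.Unary.Any using (here; there) renaming (Any to Anyⱽ)
import Data.Unit as Unit
open import Function using (_∘_; id; case_of_)
open import Relation.Binary.PropositionalEquality using (_≡_; _≢_; refl; sym; trans; cong; cong₂; subst; subst₂; ≢-sym)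
open import Relation.Nullary using (¬_; Dec; yes; no; does)
open import Relation.Nullary.Decidable using (¬?; _×-dec_)
open import Relation.Unary using (Decidable)

private
  infixl 7 _·_
  _·_ : ℕ → ℕ → ℕ
  _·_ = ℕ._*_

  variable
    A B : Set

  _∈ˡ?_ : ∀ {r} (c : Fin r) us → Dec (c ∈ˡ us)
  _∈ˡ?_ = DecMembership._∈?_ _≟_

-- Finite sums and counting

∑ : List A → (A → ℕ) → ℕ
∑ []       f = 0
∑ (x ∷ xs) f = f x + ∑ xs f

∑-mono : ∀ (xs : List A) {f g} → (∀ x → f x ≤ g x) → ∑ xs f ≤ ∑ xs g
∑-mono []       h = z≤n
∑-mono (x ∷ xs) h = +-mono-≤ (h x) (∑-mono xs h)

∑-cong : ∀ (xs : List A) {f g} → (∀ x → f x ≡ g x) → ∑ xs f ≡ ∑ xs g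
∑-cong []       h = refl
∑-cong (x ∷ xs) h = cong₂ _+_ (h x) (∑-cong xs h)

∑-+ : ∀ (xs : List A) (f g : A → ℕ) → ∑ xs (λ x → f x + g x) ≡ ∑ xs f + ∑ xs g
∑-+ []       f g = refl
∑-+ (x ∷ xs) f g rewrite ∑-+ xs f g = exchange (f x) (g x) (∑ xs f) (∑ xs g)
  where
  exchange : ∀ a b c d → a + b + (c + d) ≡ a + c + (b + d)
  exchange = solve-∀

∑-*ˡ : ∀ (xs : List A) c (f : A → ℕ) → ∑ xs (λ x → c · f x) ≡ c · ∑ xs f
∑-*ˡ []       c f = sym (*-zeroʳ c)
∑-*ˡ (x ∷ xs) c f rewrite ∑-*ˡ xs c f = sym (*-distribˡ-+ c (f x) (∑ xs f))

∑-*ʳ : ∀ (xs : List A) c (f : A → ℕ) → ∑ xs (λ x → f x · c) ≡ ∑ xs f · c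
∑-*ʳ xs c f = trans (∑-cong xs (λ x → *-comm (f x) c)) (trans (∑-*ˡ xs c f) (*-comm c (∑ xs f)))

∑-0 : ∀ (xs : List A) → ∑ xs (λ _ → 0) ≡ 0
∑-0 []       = refl
∑-0 (_ ∷ xs) = ∑-0 xs

∑-1 : ∀ (xs : List A) → ∑ xs (λ _ → 1) ≡ length xs
∑-1 []       = refl
∑-1 (_ ∷ xs) = cong suc (∑-1 xs)

∑-swap : ∀ (xs : List A) (ys : List B) (f : A → B → ℕ) →
         ∑ xs (λ x → ∑ ys (f x)) ≡ ∑ ys (λ y → ∑ xs (λ x → f x y))
∑-swap []       ys f = sym (∑-0 ys)
∑-swap (x ∷ xs) ys f rewrite ∑-swap xs ys f = sym (∑-+ ys (f x) _)

∑-++ : ∀ (xs ys : List A) f → ∑ (xs ++ ys) f ≡ ∑ xs f + ∑ ys f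
∑-++ []       ys f = refl
∑-++ (x ∷ xs) ys f rewrite ∑-++ xs ys f = sym (+-assoc (f x) _ _)

∑-map : ∀ (g : A → B) xs f → ∑ (map g xs) f ≡ ∑ xs (f ∘ g)
∑-map g []       f = refl
∑-map g (x ∷ xs) f = cong₂ _+_ refl (∑-map g xs f)

∑-cartesianProductWith : ∀ {C : Set} (g : A → B → C) xs ys f →
  ∑ (cartesianProductWith g xs ys) f ≡ ∑ xs (λ x → ∑ ys (λ y → f (g x y)))
∑-cartesianProductWith g []       ys f = refl
∑-cartesianProductWith g (x ∷ xs) ys f =
  trans (∑-++ (map (g x) ys) _ f) (cong₂ _+_ (∑-map (g x) ys f) (∑-cartesianProductWith g xs ys f))

∈⇒≤∑ : ∀ {x : A} {xs} f → x ∈ˡ xs → f x ≤ ∑ xs f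
∈⇒≤∑ f (here refl) = m≤m+n _ _
∈⇒≤∑ f (there x∈)  = ≤-trans (∈⇒≤∑ f x∈) (m≤n+m _ _)

𝟙 : {P : Set} → Dec P → ℕ
𝟙 (yes _) = 1
𝟙 (no  _) = 0

𝟙*-≤ : ∀ {P : Set} (P? : Dec P) {c m} → (P → c ≤ m) → 𝟙 P? · c ≤ m
𝟙*-≤ (yes p) {c} h = subst (_≤ _) (sym (*-identityˡ c)) (h p)
𝟙*-≤ (no _)  h     = z≤n

𝟙-≤ : ∀ {P : Set} (P? : Dec P) {m} → (P → 1 ≤ m) → 𝟙 P? ≤ m
𝟙-≤ (yes p) h = h p
𝟙-≤ (no _)  h = z≤n

1≤𝟙 : ∀ {P : Set} (P? : Dec P) → P → 1 ≤ 𝟙 P?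
1≤𝟙 (yes _)  p = ≤-refl
1≤𝟙 (no ¬p) p = ⊥-elim (¬p p)

count : {P : A → Set} → Decidable P → List A → ℕ
count P? xs = ∑ xs (λ x → 𝟙 (P? x))

# : ∀ {n} {P : Fin n → Set} → Decidable P → ℕ
# {n} P? = count P? (allFin n)

length-filter≡count : ∀ {P : A → Set} (P? : Decidable P) xs → length (filter P? xs) ≡ count P? xs
length-filter≡count P? [] = refl
length-filter≡count P? (x ∷ xs) with P? x
... | yes _ = cong suc (length-filter≡count P? xs)
... | no  _ = length-filter≡count P? xs

∑-allFin-suc : ∀ n (f : Fin (suc n) → ℕ) → ∑ (allFin (suc n)) f ≡ f zero + ∑ (allFin n) (f ∘ suc)
∑-allFin-suc n f = cong₂ _+_ refl
  (trans (cong (λ xs → ∑ xs f) (sym (map-tabulate {n = n} id suc))) (∑-map suc (allFin n) f))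

∑-allFin-1 : ∀ n → ∑ (allFin n) (λ _ → 1) ≡ n
∑-allFin-1 zero    = refl
∑-allFin-1 (suc n) = trans (∑-allFin-suc n (λ _ → 1)) (cong suc (∑-allFin-1 n))

≤∑-cover : ∀ {n} (f : Fin n → ℕ) → (∀ x → 1 ≤ f x) → n ≤ ∑ (allFin n) f
≤∑-cover {n} f h = ≤-trans (≤-reflexive (sym (∑-allFin-1 n))) (∑-mono (allFin n) h)

#-complement : ∀ {n} {P : Fin n → Set} (P? : Decidable P) → # P? + # (λ x → ¬? (P? x)) ≡ n
#-complement {n} P? = trans (sym (∑-+ (allFin n) _ _)) (trans (∑-cong (allFin n) one) (∑-allFin-1 n))
  where
  one : ∀ x → 𝟙 (P? x) + 𝟙 (¬? (P? x)) ≡ 1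
  one x with P? x
  ... | yes _ = refl
  ... | no  _ = refl

∣S∣≡# : ∀ {n} (S : Subset n) → ∣ S ∣ ≡ # (_∈? S)
∣S∣≡# []          = refl
∣S∣≡# (s ∷ S) = trans (head s) (sym (∑-allFin-suc _ (λ x → 𝟙 (x ∈? (s ∷ S)))))
  where
  shift : ∀ s x → 𝟙 (x ∈? S) ≡ 𝟙 (suc x ∈? (s ∷ S))
  shift s x with x ∈? S
  ... | yes _ = refl
  ... | no  _ = refl
  head : ∀ s → ∣ s ∷ S ∣ ≡ 𝟙 (zero ∈? (s ∷ S)) + ∑ (allFin _) (λ x → 𝟙 (suc x ∈? (s ∷ S)))
  head true  = cong suc (trans (∣S∣≡# S) (∑-cong (allFin _) (shift true)))
  head false = trans (∣S∣≡# S) (∑-cong (allFin _) (shift false))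

Unique⇒length≤# : ∀ {n} (us : List (Fin n)) {P : Fin n → Set} (P? : Decidable P) →
                  Unique us → All P us → length us ≤ # P?
Unique⇒length≤# []       P? _        _        = z≤n
Unique⇒length≤# {n} (u ∷ us) {P} P? (u≢ ∷ uus) (pu ∷ pus) = begin
  1 + length us              ≤⟨ +-mono-≤ one (Unique⇒length≤# us P≢? uus (All.zip (pus , u≢))) ⟩
  # (u ≟_) + # P≢?           ≡⟨ sym (∑-+ (allFin n) _ _) ⟩
  ∑ (allFin n) (λ x → 𝟙 (u ≟ x) + 𝟙 (P≢? x)) ≤⟨ ∑-mono (allFin n) split ⟩
  # P?                       ∎
  where
  open ≤-Reasoning
  P≢? : Decidable (λ x → P x × u ≢ x)
  P≢? x = P? x ×-dec ¬? (u ≟ x)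
  one : 1 ≤ # (u ≟_)
  one = ≤-trans (1≤𝟙 (u ≟ u) refl) (∈⇒≤∑ (λ x → 𝟙 (u ≟ x)) (∈-allFin u))
  split : ∀ x → 𝟙 (u ≟ x) + 𝟙 (P≢? x) ≤ 𝟙 (P? x)
  split x with u ≟ x | P? x
  ... | yes refl | yes _  = ≤-refl
  ... | yes refl | no ¬p = ⊥-elim (¬p pu)
  ... | no _     | yes _  = ≤-refl
  ... | no _     | no _   = ≤-refl

-- If every element of `Fin r` occurred in `us`, positions would map `Fin r` injectively into a
-- shorter list.
fresh : ∀ {r} (us : List (Fin r)) → length us ℕ.< r → ∃ λ c → All (c ≢_) us
fresh {r} us us<r with all? (_∈ˡ? us)
... | no ¬all = case ¬∀⟶∃¬ r _ (_∈ˡ? us) ¬all of λ (c , c∉us) → c , ¬Any⇒All¬ us c∉us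
... | yes all with pigeonhole us<r (λ c → index (all c))
...   | c , c′ , c<c′ , eq = ⊥-elim (Fin.<⇒≢ c<c′
        (trans (lookup-index (all c)) (trans (cong (lookup us) eq) (sym (lookup-index (all c′))))))

#≤1 : ∀ {n} {P : Fin n → Set} (P? : Decidable P) → (∀ x y → P x → P y → x ≡ y) → # P? ≤ 1
#≤1 {zero}  P? unique = z≤n
#≤1 {suc n} P? unique rewrite ∑-allFin-suc n (λ x → 𝟙 (P? x)) with P? zero
... | no _   = #≤1 (P? ∘ suc) (λ x y px py → Fin.suc-injective (unique (suc x) (suc y) px py))
... | yes p₀ = s≤s (≤-trans (∑-mono (allFin n) (λ x → 𝟙-≤ (P? (suc x)) (λ p → case unique zero (suc x) p₀ p of λ ())))
                            (≤-reflexive (∑-0 (allFin n))))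

-- Subsets and tuples

0C : ∀ k → 0 C suc k ≡ 0
0C k = k>n⇒nCk≡0 {n = 0} {k = suc k} (s≤s z≤n)

nCk≤n^k : ∀ n k → n C k ≤ n ^ k
nCk≤n^k n       zero    = ≤-refl
nCk≤n^k zero    (suc k) = ≤-reflexive (0C k)
nCk≤n^k (suc n) (suc k) = begin
  suc n C suc k        ≡⟨ sym (nCk+nC[k+1]≡[n+1]C[k+1] n k) ⟩
  n C k + n C suc k    ≤⟨ +-mono-≤ (nCk≤n^k n k) (nCk≤n^k n (suc k)) ⟩
  suc n · n ^ k        ≤⟨ *-monoʳ-≤ (suc n) (^-monoˡ-≤ k (n≤1+n n)) ⟩
  suc n · suc n ^ k    ∎
  where open ≤-Reasoning

count-subsets : ∀ n k → count (λ (e : Subset n) → ∣ e ∣ ℕ.≟ k) (allSubsets n) ≡ n C k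
count-subsets zero    zero    = refl
count-subsets zero    (suc k) = sym (0C k)
count-subsets (suc n) k = trans split (recurse k)
  where
  size : ∀ {m} j (e : Subset m) → ℕ
  size j e = 𝟙 (∣ e ∣ ℕ.≟ j)
  split : ∑ (allSubsets (suc n)) (size k)
          ≡ ∑ (allSubsets n) (size k ∘ (true ∷_)) + ∑ (allSubsets n) (size k ∘ (false ∷_))
  split = trans (∑-++ (map (true ∷_) (allSubsets n)) _ (size k))
                (cong₂ _+_ (∑-map (true ∷_) (allSubsets n) _) (∑-map (false ∷_) (allSubsets n) _))
  shift : ∀ j (e : Subset n) → size (suc j) (true ∷ e) ≡ size j e
  shift j e with suc ∣ e ∣ ℕ.≟ suc j | ∣ e ∣ ℕ.≟ j
  ... | yes _   | yes _   = refl
  ... | yes eq  | no ≢    = ⊥-elim (≢ (suc-injective eq))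
  ... | no ≢    | yes eq  = ⊥-elim (≢ (cong suc eq))
  ... | no _    | no _    = refl
  recurse : ∀ j → ∑ (allSubsets n) (size j ∘ (true ∷_)) + ∑ (allSubsets n) (size j ∘ (false ∷_)) ≡ suc n C j
  recurse zero = cong₂ _+_ (trans (∑-cong (allSubsets n) (λ _ → refl)) (∑-0 (allSubsets n))) (count-subsets n zero)
  recurse (suc j) = trans
    (cong₂ _+_ (trans (∑-cong (allSubsets n) (shift j)) (count-subsets n j)) (count-subsets n (suc j)))
    (nCk+nC[k+1]≡[n+1]C[k+1] n j)

NonEdge : ∀ {n} → Hypergraph n → ℕ → Subset n → Set
NonEdge G k e = ∣ e ∣ ≡ k × G e ≡ false

nonEdge? : ∀ {n} (G : Hypergraph n) k → Decidable (NonEdge G k)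
nonEdge? G k e = (∣ e ∣ ℕ.≟ k) ×-dec (G e Bool.≟ false)

edges+nonEdges : ∀ {n} (G : Hypergraph n) k → Uniform k G →
  edgeCount G + count (nonEdge? G k) (allSubsets n) ≡ n C k
edges+nonEdges {n} G k uniform = trans
  (cong₂ _+_ (length-filter≡count _ (allSubsets n)) refl)
  (trans (sym (∑-+ (allSubsets n) _ _)) (trans (∑-cong (allSubsets n) split) (count-subsets n k)))
  where
  split : ∀ e → 𝟙 (Bool.T? (G e)) + 𝟙 (nonEdge? G k e) ≡ 𝟙 (∣ e ∣ ℕ.≟ k)
  split e with G e in eq | ∣ e ∣ ℕ.≟ k
  ... | true  | yes _  = refl
  ... | true  | no ≢k  = ⊥-elim (≢k (uniform e eq))
  ... | false | yes _  = refl
  ... | false | no _   = refl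

tuples : ∀ n k → List (Vec (Fin n) k)
tuples n zero    = [] ∷ []
tuples n (suc k) = cartesianProductWith _∷_ (allFin n) (tuples n k)

∑-tuples-suc : ∀ n k f → ∑ (tuples n (suc k)) f ≡ ∑ (allFin n) (λ x → ∑ (tuples n k) (λ t → f (x ∷ t)))
∑-tuples-suc n k f = ∑-cartesianProductWith _∷_ (allFin n) (tuples n k) f

-- A product of indicators, so that the sum over all tuples factors into a power of `∣ e ∣`.
within : ∀ {n k} → Subset n → Vec (Fin n) k → ℕ
within e []      = 1
within e (x ∷ t) = 𝟙 (x ∈? e) · within e t

1≤within : ∀ {n k} (e : Subset n) (t : Vec (Fin n) k) → Allⱽ (_∈ e) t → 1 ≤ within e t
1≤within e []      []         = ≤-refl
1≤within e (x ∷ t) (x∈e ∷ ts) = *-mono-≤ (1≤𝟙 (x ∈? e) x∈e) (1≤within e t ts)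

∑-within : ∀ {n} k (e : Subset n) → ∑ (tuples n k) (within e) ≡ ∣ e ∣ ^ k
∑-within zero    e = refl
∑-within {n} (suc k) e = trans (∑-tuples-suc n k (within e)) (trans
  (∑-cong (allFin n) (λ x → ∑-*ˡ (tuples n k) (𝟙 (x ∈? e)) (within e)))
  (trans (∑-*ʳ (allFin n) _ _) (cong₂ _·_ (sym (∣S∣≡# e)) (∑-within k e))))

superset : ∀ {n} k (p : Subset n) → ∣ p ∣ ≤ k → k ≤ n → ∃ λ e → p ⊆ e × ∣ e ∣ ≡ k
superset zero    []          _       _         = [] , ⊆-refl , refl
superset zero    (false ∷ p) p≤k     _         =
  let e , p⊆e , eq = superset zero p p≤k z≤n in false ∷ e , s⊆s p⊆e , eq
superset (suc k) (true ∷ p)  (s≤s p≤k) (s≤s k≤n) =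
  let e , p⊆e , eq = superset k p p≤k k≤n in true ∷ e , s⊆s p⊆e , cong suc eq
superset {suc n} (suc k) (false ∷ p) p≤k (s≤s k≤n) with suc k ≤? n
... | yes k<n = let e , p⊆e , eq = superset (suc k) p p≤k k<n in false ∷ e , s⊆s p⊆e , eq
-- Here `n ≤ k`, so the tail is too short to hold `suc k` elements and the head must be added.
... | no  k≮n = let e , p⊆e , eq = superset k p (≤-trans (∣p∣≤n p) (≤-pred (≰⇒> k≮n))) k≤n in
                true ∷ e , out⊆ p⊆e , cong suc eq

∣⁅x⁆∪p∣≤ : ∀ {n} (x : Fin n) p → ∣ ⁅ x ⁆ ∪ p ∣ ≤ suc ∣ p ∣
∣⁅x⁆∪p∣≤ zero    (true  ∷ p) rewrite ∪-identityˡ p = n≤1+n _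
∣⁅x⁆∪p∣≤ zero    (false ∷ p) rewrite ∪-identityˡ p = ≤-refl
∣⁅x⁆∪p∣≤ (suc x) (true  ∷ p) = s≤s (∣⁅x⁆∪p∣≤ x p)
∣⁅x⁆∪p∣≤ (suc x) (false ∷ p) = ∣⁅x⁆∪p∣≤ x p

support : ∀ {n k} (t : Vec (Fin n) k) → ∃ λ p → Allⱽ (_∈ p) t × ∣ p ∣ ≤ k
support {n} []  = Subset.⊥ , [] , ≤-reflexive (∣⊥∣≡0 n)
support (x ∷ t) =
  let p , t⊆p , p≤k = support t in
  ⁅ x ⁆ ∪ p , p⊆p∪q p (x∈⁅x⁆ x) ∷ Allⱽ.map (q⊆p∪q ⁅ x ⁆ p) t⊆p , ≤-trans (∣⁅x⁆∪p∣≤ x p) (s≤s p≤k)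

-- Entries may repeat, so the support can have fewer than `k` elements and is then enlarged.
tuple⊆subset : ∀ {n k} → k ≤ n → (t : Vec (Fin n) k) → ∃ λ e → Allⱽ (_∈ e) t × ∣ e ∣ ≡ k
tuple⊆subset {k = k} k≤n t =
  let p , t⊆p , p≤k = support t
      e , p⊆e , eq  = superset k p p≤k k≤n
  in e , Allⱽ.map p⊆e t⊆p , eq

∈-allSubsets : ∀ {n} (e : Subset n) → e ∈ˡ allSubsets n
∈-allSubsets []          = here refl
∈-allSubsets (true  ∷ e) = ∈-++⁺ˡ (∈-map⁺ (true ∷_) (∈-allSubsets e))
∈-allSubsets {suc n} (false ∷ e) = ∈-++⁺ʳ (map (true ∷_) (allSubsets n)) (∈-map⁺ (false ∷_) (∈-allSubsets e))

-- The weight that transfers counts of tuples to counts of non-edges: it is at least 1 on a tuple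
-- lying in no edge, and each non-edge contributes `k ^ k` to its total.
nonEdgesOver : ∀ {n} → Hypergraph n → (k : ℕ) → Vec (Fin n) k → ℕ
nonEdgesOver {n} G k t = ∑ (allSubsets n) (λ e → 𝟙 (nonEdge? G k e) · within e t)

1≤nonEdgesOver : ∀ {n} (G : Hypergraph n) k → k ≤ n → (t : Vec (Fin n) k) →
  (∀ e → Allⱽ (_∈ e) t → G e ≡ false) → 1 ≤ nonEdgesOver G k t
1≤nonEdgesOver G k k≤n t missing =
  let e , t⊆e , eq = tuple⊆subset k≤n t in
  ≤-trans (*-mono-≤ (1≤𝟙 (nonEdge? G k e) (eq , missing e t⊆e)) (1≤within e t t⊆e))
          (∈⇒≤∑ (λ e → 𝟙 (nonEdge? G k e) · within e t) (∈-allSubsets e))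

∑-nonEdgesOver : ∀ {n} (G : Hypergraph n) k →
  ∑ (tuples n k) (nonEdgesOver G k) ≤ k ^ k · count (nonEdge? G k) (allSubsets n)
∑-nonEdgesOver {n} G k = begin
  ∑ (tuples n k) (nonEdgesOver G k)
    ≡⟨ ∑-swap (tuples n k) (allSubsets n) _ ⟩
  ∑ (allSubsets n) (λ e → ∑ (tuples n k) (λ t → 𝟙 (nonEdge? G k e) · within e t))
    ≡⟨ ∑-cong (allSubsets n) (λ e → trans (∑-*ˡ (tuples n k) (𝟙 (nonEdge? G k e)) (within e)) (cong (𝟙 (nonEdge? G k e) ·_) (∑-within k e))) ⟩
  ∑ (allSubsets n) (λ e → 𝟙 (nonEdge? G k e) · ∣ e ∣ ^ k)
    ≤⟨ ∑-mono (allSubsets n) (λ e → 𝟙*-≤ (nonEdge? G k e) (λ (eq , ne) →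
         subst (λ j → j ^ k ≤ k ^ k · 𝟙 (nonEdge? G k e)) (sym eq)
           (m≤m*n (k ^ k) _ {{>-nonZero (1≤𝟙 (nonEdge? G k e) (eq , ne))}}))) ⟩
  ∑ (allSubsets n) (λ e → k ^ k · 𝟙 (nonEdge? G k e))
    ≡⟨ ∑-*ˡ (allSubsets n) (k ^ k) _ ⟩
  k ^ k · count (nonEdge? G k) (allSubsets n) ∎
  where open ≤-Reasoning

-- Components

module _ {n r} {G : Hypergraph n} {χ : Colouring n r} {c : Fin r} where

  Conn-trans : ∀ {u v w} → Conn G χ c u v → Conn G χ c v w → Conn G χ c u w
  Conn-trans p here                        = p
  Conn-trans p (step q e e∈G χe≡c u∈e w∈e) = step (Conn-trans p q) e e∈G χe≡c u∈e w∈e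

  Conn-sym : ∀ {u v} → Conn G χ c u v → Conn G χ c v u
  Conn-sym here                        = here
  Conn-sym (step q e e∈G χe≡c u∈e w∈e) = Conn-trans (step here e e∈G χe≡c w∈e u∈e) (Conn-sym q)

Adjacent : ∀ {n r} → Hypergraph n → Colouring n r → Fin r → Fin n × Fin n → Set
Adjacent G χ c (u , w) = ∃ λ e → G e ≡ true × χ e ≡ c × u ∈ e × w ∈ e

adjacent? : ∀ {n r} (G : Hypergraph n) (χ : Colouring n r) c → Decidable (Adjacent G χ c)
adjacent? G χ c (u , w) =
  anySubset? (λ e → (G e Bool.≟ true) ×-dec (χ e ≟ c) ×-dec (u ∈? e) ×-dec (w ∈? e))

-- Labels arise by merging the classes of one adjacent pair after another, so that lying in the same
-- class is decidable.
mergeAll : ∀ {n r} (G : Hypergraph n) (χ : Colouring n r) c (ps : List (Fin n × Fin n)) →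
  Σ (Fin n → Fin n) λ ℓ → (∀ u v → ℓ u ≡ ℓ v → Conn G χ c u v)
                        × All (λ (u , w) → Adjacent G χ c (u , w) → ℓ u ≡ ℓ w) ps
mergeAll G χ c [] = id , (λ { u .u refl → here }) , []
mergeAll {n} G χ c ((u , w) ∷ ps) with mergeAll G χ c ps | adjacent? G χ c (u , w)
... | ℓ , sound , respects | no ¬uw = ℓ , sound , (λ uw → ⊥-elim (¬uw uw)) ∷ respects
... | ℓ , sound , respects | yes (e , e∈G , χe≡c , u∈e , w∈e) =
      relabel ∘ ℓ , sound′ , (λ _ → merged) ∷ All.map (λ h adj → cong relabel (h adj)) respects
  where
  relabel : Fin n → Fin n
  relabel a with a ≟ ℓ u
  ... | yes _ = ℓ w
  ... | no  _ = a
  u~w : Conn G χ c u w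
  u~w = step here e e∈G χe≡c u∈e w∈e
  merged : relabel (ℓ u) ≡ relabel (ℓ w)
  merged with ℓ u ≟ ℓ u | ℓ w ≟ ℓ u
  ... | yes _ | yes _ = refl
  ... | yes _ | no _  = refl
  ... | no ≢  | _     = ⊥-elim (≢ refl)
  sound′ : ∀ a b → relabel (ℓ a) ≡ relabel (ℓ b) → Conn G χ c a b
  sound′ a b eq with ℓ a ≟ ℓ u | ℓ b ≟ ℓ u
  ... | yes p | yes q = sound a b (trans p (sym q))
  -- Only `a` had the label of `u`, so `b` has the label of `w`: the walk runs from `a` to `u`,
  -- across `e` to `w`, and on to `b`.
  ... | yes p | no _  = Conn-trans (sound a u p) (Conn-trans u~w (sound w b eq))
  ... | no _  | yes q = Conn-sym (Conn-trans (sound b u q) (Conn-trans u~w (sound w a (sym eq))))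
  ... | no _  | no _  = sound a b eq

components : ∀ {n r} (G : Hypergraph n) (χ : Colouring n r) c →
  Σ (Fin n → Fin n) λ ℓ → (∀ u v → ℓ u ≡ ℓ v → Conn G χ c u v)
                        × (∀ u w → Adjacent G χ c (u , w) → ℓ u ≡ ℓ w)
components {n} G χ c =
  let ℓ , sound , respects = mergeAll G χ c (cartesianProduct (allFin n) (allFin n))
  in ℓ , sound , λ u w → All.lookup respects (∈-cartesianProduct⁺ (∈-allFin u) (∈-allFin w))

-- Typical vertices

module Typical {n Q : ℕ} {{_ : NonZero n}} {Bad : Fin n → Fin n → Set} (bad? : ∀ x → Decidable (Bad x))
               (few : Q · Q · ∑ (allFin n) (λ x → # (bad? x)) ≤ n · n) where

  Good : Fin n → Set
  Good x = Q · # (bad? x) ≤ n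

  good? : Decidable Good
  good? x = Q · # (bad? x) ≤? n

  Ok : List (Fin n) → Fin n → Set
  Ok rs z = Good z × All (λ x → ¬ Bad x z) rs

  ok? : ∀ rs → Decidable (Ok rs)
  ok? rs z = good? z ×-dec All.all? (λ x → ¬? (bad? x z)) rs

  exceptions : List (Fin n) → ℕ
  exceptions rs = # (λ z → ¬? (ok? rs z))

  -- By Markov's inequality at most `n / Q` vertices are not good, and each good reference vertex is
  -- bad with at most `n / Q` others.
  Q*exceptions≤ : ∀ rs → All Good rs → Q · exceptions rs ≤ suc (length rs) · n
  Q*exceptions≤ [] [] = *-cancelʳ-≤ _ _ n (begin
    Q · exceptions [] · n                                    ≡⟨ *-assoc Q _ n ⟩
    Q · (exceptions [] · n)                                  ≡⟨ cong (Q ·_) (sym (∑-*ʳ (allFin n) n _)) ⟩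
    Q · ∑ (allFin n) (λ z → 𝟙 (¬? (ok? [] z)) · n)           ≤⟨ *-monoʳ-≤ Q (∑-mono (allFin n) λ z →
                                                                  𝟙*-≤ (¬? (ok? [] z)) λ ¬ok → <⇒≤ (≰⇒> λ g → ¬ok (g , []))) ⟩
    Q · ∑ (allFin n) (λ z → Q · # (bad? z))                  ≡⟨ cong (Q ·_) (∑-*ˡ (allFin n) Q _) ⟩
    Q · (Q · ∑ (allFin n) (λ z → # (bad? z)))                ≡⟨ sym (*-assoc Q Q _) ⟩
    Q · Q · ∑ (allFin n) (λ z → # (bad? z))                  ≤⟨ few ⟩
    n · n                                                    ≡⟨ cong (_· n) (sym (+-identityʳ n)) ⟩
    1 · n · n                                                ∎)
    where open ≤-Reasoning
  Q*exceptions≤ (x ∷ rs) (gx ∷ grs) = begin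
    Q · exceptions (x ∷ rs)                   ≤⟨ *-monoʳ-≤ Q (∑-mono (allFin n) split) ⟩
    Q · ∑ (allFin n) (λ z → 𝟙 (bad? x z) + 𝟙 (¬? (ok? rs z)))
                                              ≡⟨ cong (Q ·_) (∑-+ (allFin n) _ _) ⟩
    Q · (# (bad? x) + exceptions rs)          ≡⟨ *-distribˡ-+ Q _ _ ⟩
    Q · # (bad? x) + Q · exceptions rs        ≤⟨ +-mono-≤ gx (Q*exceptions≤ rs grs) ⟩
    suc (suc (length rs)) · n                 ∎
    where
    open ≤-Reasoning
    split : ∀ z → 𝟙 (¬? (ok? (x ∷ rs) z)) ≤ 𝟙 (bad? x z) + 𝟙 (¬? (ok? rs z))
    split z = 𝟙-≤ (¬? (ok? (x ∷ rs) z)) λ ¬ok → case bad? x z of λ where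
      (yes b) → ≤-trans (1≤𝟙 (bad? x z) b) (m≤m+n _ _)
      (no ¬b) → ≤-trans (1≤𝟙 (¬? (ok? rs z)) (λ (g , ¬bs) → ¬ok (g , ¬b ∷ ¬bs))) (m≤n+m _ _)

  typical-≤ : ∀ rs → All Good rs → (f : Fin n → ℕ) → (∀ z → Ok rs z → 1 ≤ f z) →
              Q · n ≤ Q · ∑ (allFin n) f + suc (length rs) · n
  typical-≤ rs grs f h = begin
    Q · n                                        ≤⟨ *-monoʳ-≤ Q (≤∑-cover (λ z → f z + 𝟙 (¬? (ok? rs z))) cover) ⟩
    Q · ∑ (allFin n) (λ z → f z + 𝟙 (¬? (ok? rs z))) ≡⟨ cong (Q ·_) (∑-+ (allFin n) f _) ⟩
    Q · (∑ (allFin n) f + exceptions rs)         ≡⟨ *-distribˡ-+ Q _ _ ⟩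
    Q · ∑ (allFin n) f + Q · exceptions rs       ≤⟨ +-monoʳ-≤ _ (Q*exceptions≤ rs grs) ⟩
    Q · ∑ (allFin n) f + suc (length rs) · n     ∎
    where
    open ≤-Reasoning
    cover : ∀ z → 1 ≤ f z + 𝟙 (¬? (ok? rs z))
    cover z with ok? rs z
    ... | yes ok = ≤-trans (h z ok) (m≤m+n _ _)
    ... | no  _  = m≤n+m _ _

-- Systems of partitions, given by labellings of the vertices

module Partitions {n r : ℕ} (ℓ : Fin r → Fin n → Fin n) where

  Split : Fin r → Fin n → Fin n → Set
  Split i x y = ℓ i x ≢ ℓ i y

  split? : ∀ i x → Decidable (Split i x)
  split? i x y = ¬? (ℓ i x ≟ ℓ i y)

  sameClass? : ∀ i x → Decidable (λ y → ℓ i x ≡ ℓ i y)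
  sameClass? i x y = ℓ i x ≟ ℓ i y

  dist : Fin n → Fin n → ℕ
  dist x y = # (λ i → split? i x y)

  far? : ∀ d x → Decidable (λ y → d ≤ dist x y)
  far? d x y = d ≤? dist x y

  -- Averaging over the first entry: at least `n / a` choices satisfy `P`, and each carries weight
  -- at least `(n / a) ^ m` on the remaining entries.
  tuples-step : ∀ a m f {P : Fin n → Set} (P? : Decidable P) → n ≤ a · # P? →
    (∀ z → P z → n ^ m ≤ a ^ m · ∑ (tuples n m) (λ t → f (z ∷ t))) →
    n ^ suc m ≤ a ^ suc m · ∑ (tuples n (suc m)) f
  tuples-step a m f P? many h = begin
    n · n ^ m                                         ≤⟨ *-monoˡ-≤ (n ^ m) many ⟩
    a · # P? · n ^ m                                  ≡⟨ *-assoc a _ _ ⟩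
    a · (# P? · n ^ m)                                ≡⟨ cong (a ·_) (sym (∑-*ʳ (allFin n) _ _)) ⟩
    a · ∑ (allFin n) (λ z → 𝟙 (P? z) · n ^ m)         ≤⟨ *-monoʳ-≤ a (∑-mono (allFin n) λ z → 𝟙*-≤ (P? z) (h z)) ⟩
    a · ∑ (allFin n) (λ z → a ^ m · ∑ (tuples n m) (λ t → f (z ∷ t)))
                                                      ≡⟨ cong (a ·_) (∑-*ˡ (allFin n) (a ^ m) _) ⟩
    a · (a ^ m · ∑ (allFin n) (λ z → ∑ (tuples n m) (λ t → f (z ∷ t))))
                                                      ≡⟨ sym (*-assoc a _ _) ⟩
    a ^ suc m · ∑ (allFin n) (λ z → ∑ (tuples n m) (λ t → f (z ∷ t)))
                                                      ≡⟨ cong (a ^ suc m ·_) (sym (∑-tuples-suc n m f)) ⟩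
    a ^ suc m · ∑ (tuples n (suc m)) f                ∎
    where open ≤-Reasoning

  -- Few pairs of vertices at large distance

  module Counting (a : ℕ) {{_ : NonZero a}} (spread : ∀ i x → n ≤ a · # (split? i x)) where

    -- The entries serve the partitions of `L` in turn: `spread` offers at least `n / a` vertices
    -- that the current partition splits from `x`. Once `L` is exhausted the remaining entries are
    -- free.
    many-splitting : ∀ x L m → length L ≤ m → (f : Vec (Fin n) m → ℕ) →
      (∀ v → All (λ i → Anyⱽ (Split i x) v) L → 1 ≤ f v) → n ^ m ≤ a ^ m · ∑ (tuples n m) f
    many-splitting x []      zero    _         f h = *-mono-≤ {1} ≤-refl (≤-trans (h [] []) (m≤m+n (f []) 0))
    many-splitting x []      (suc m) _         f h =
      tuples-step a m f {λ _ → Unit.⊤} (λ _ → yes Unit.tt)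
        (subst (λ j → n ≤ a · j) (sym (∑-allFin-1 n)) (m≤n*m n a))
        (λ z _ → many-splitting x [] m z≤n (f ∘ (z ∷_)) (λ v _ → h (z ∷ v) []))
    many-splitting x (i ∷ L) (suc m) (s≤s L≤m) f h =
      tuples-step a m f (split? i x) (spread i x)
        (λ z sz → many-splitting x L m L≤m (f ∘ (z ∷_)) (λ v sv → h (z ∷ v) (here sz ∷ All.map there sv)))

    -- A pair split by at least `d` partitions leaves at most `m` to be split, and `m` further
    -- vertices can do so. Hence the tuples starting with such a pair have total weight at least
    -- `(n / a) ^ m`.
    few-far : ∀ d m → r ≤ d + m → (f : Vec (Fin n) (2 + m) → ℕ) →
      (∀ x t → (∀ i → Anyⱽ (Split i x) t) → 1 ≤ f (x ∷ t)) →
      ∑ (allFin n) (λ x → # (far? d x)) · n ^ m ≤ a ^ m · ∑ (tuples n (2 + m)) f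
    few-far d m r≤d+m f h = begin
      ∑ (allFin n) (λ x → # (far? d x)) · n ^ m   ≡⟨ sym (∑-*ʳ (allFin n) _ _) ⟩
      ∑ (allFin n) (λ x → # (far? d x) · n ^ m)   ≤⟨ ∑-mono (allFin n) perVertex ⟩
      ∑ (allFin n) (λ x → a ^ m · ∑ (tuples n (suc m)) (λ t → f (x ∷ t)))
                                                  ≡⟨ ∑-*ˡ (allFin n) (a ^ m) _ ⟩
      a ^ m · ∑ (allFin n) (λ x → ∑ (tuples n (suc m)) (λ t → f (x ∷ t)))
                                                  ≡⟨ cong (a ^ m ·_) (sym (∑-tuples-suc n (suc m) f)) ⟩
      a ^ m · ∑ (tuples n (2 + m)) f              ∎
      where
      open ≤-Reasoning
      perPair : ∀ x y → d ≤ dist x y → n ^ m ≤ a ^ m · ∑ (tuples n m) (λ v → f (x ∷ y ∷ v))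
      perPair x y d≤ = many-splitting x rest m rest≤m _ λ v sv → h x (y ∷ v) (hit sv)
        where
        rest : List (Fin r)
        rest = filter (λ i → sameClass? i x y) (allFin r)
        rest≤m : length rest ≤ m
        rest≤m = +-cancelˡ-≤ d _ _ (begin
          d + length rest                ≤⟨ +-monoˡ-≤ _ d≤ ⟩
          dist x y + length rest         ≡⟨ +-comm (dist x y) _ ⟩
          length rest + dist x y         ≡⟨ cong₂ _+_ (length-filter≡count _ (allFin r)) refl ⟩
          # (λ i → sameClass? i x y) + dist x y ≡⟨ #-complement (λ i → sameClass? i x y) ⟩
          r                              ≤⟨ r≤d+m ⟩
          d + m                          ∎)
        hit : ∀ {v} → All (λ i → Anyⱽ (Split i x) v) rest → ∀ i → Anyⱽ (Split i x) (y ∷ v)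
        hit sv i with sameClass? i x y
        ... | no  s  = here s
        ... | yes eq = there (All.lookup sv (∈-filter⁺ (λ i → sameClass? i x y) (∈-allFin i) eq))
      perVertex : ∀ x → # (far? d x) · n ^ m ≤ a ^ m · ∑ (tuples n (suc m)) (λ t → f (x ∷ t))
      perVertex x = begin
        # (far? d x) · n ^ m                           ≡⟨ sym (∑-*ʳ (allFin n) _ _) ⟩
        ∑ (allFin n) (λ y → 𝟙 (far? d x y) · n ^ m)    ≤⟨ ∑-mono (allFin n) (λ y → 𝟙*-≤ (far? d x y) (perPair x y)) ⟩
        ∑ (allFin n) (λ y → a ^ m · ∑ (tuples n m) (λ v → f (x ∷ y ∷ v)))
                                                       ≡⟨ ∑-*ˡ (allFin n) (a ^ m) _ ⟩
        a ^ m · ∑ (allFin n) (λ y → ∑ (tuples n m) (λ v → f (x ∷ y ∷ v)))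
                                                       ≡⟨ cong (a ^ m ·_) (sym (∑-tuples-suc n m (λ t → f (x ∷ t)))) ⟩
        a ^ m · ∑ (tuples n (suc m)) (λ t → f (x ∷ t)) ∎

  -- Vertices within Hamming distance 1 or 2

  Near : ℕ → Fin n → Fin n → Set
  Near d x y = ¬ (d ≤ dist x y)

  near₂ : ∀ {x y s t} → Near 2 x y → s ≢ t → Split s x y → ℓ t x ≡ ℓ t y
  near₂ {x} {y} {s} {t} near s≢t Ds with ℓ t x ≟ ℓ t y
  ... | yes eq = eq
  ... | no  Dt = ⊥-elim (near (Unique⇒length≤# (s ∷ t ∷ []) (λ i → split? i x y)
                   ((s≢t ∷ []) ∷ [] ∷ []) (Ds ∷ Dt ∷ [])))

  near₃ : ∀ {x y s t} w → Near 3 x y → s ≢ t → w ≢ s → w ≢ t → Split s x y → Split t x y → ℓ w x ≡ ℓ w y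
  near₃ {x} {y} {s} {t} w near s≢t w≢s w≢t Ds Dt with ℓ w x ≟ ℓ w y
  ... | yes eq = eq
  ... | no  Dw = ⊥-elim (near (Unique⇒length≤# (s ∷ t ∷ w ∷ []) (λ i → split? i x y)
                   ((s≢t ∷ ≢-sym w≢s ∷ []) ∷ (≢-sym w≢t ∷ []) ∷ [] ∷ []) (Ds ∷ Dt ∷ Dw ∷ [])))

  -- x and y differ exactly in the coordinates i and j.
  module Square {x y i j} (i≢j : i ≢ j) (nxy : Near 3 x y) (Di : Split i x y) (Dj : Split j x y) where

    xy-agree : ∀ {s} → s ≢ i → s ≢ j → ℓ s x ≡ ℓ s y
    xy-agree {s} s≢i s≢j = near₃ s nxy i≢j s≢i s≢j Di Dj

    Corner : Fin n → Set
    Corner z = ℓ i x ≡ ℓ i z × ℓ j y ≡ ℓ j z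

    OppositeCorner : Fin n → Set
    OppositeCorner z = ℓ j x ≡ ℓ j z × ℓ i y ≡ ℓ i z

    -- Since `z` differs from both `x` and `y` in `p`, it differs from each in at most one of `i`
    -- and `j`. As `x` and `y` differ in both, `z` takes one of these coordinates from each.
    corner : ∀ {z p} → p ≢ i → p ≢ j → Near 3 x z → Near 3 y z → Split p x z → Corner z ⊎ OppositeCorner z
    corner {z} {p} p≢i p≢j nxz nyz Dp with ℓ i x ≟ ℓ i z
    ... | yes eq = inj₁ (eq , near₃ j nyz p≢i (≢-sym p≢j) (≢-sym i≢j) Dp′ (λ e → Di (trans eq (sym e))))
      where
      Dp′ : Split p y z
      Dp′ e = Dp (trans (xy-agree p≢i p≢j) e)
    ... | no Diz = inj₂ (xj , near₃ i nyz p≢j (≢-sym p≢i) i≢j Dp′ (λ e → Dj (trans xj (sym e))))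
      where
      Dp′ : Split p y z
      Dp′ e = Dp (trans (xy-agree p≢i p≢j) e)
      xj : ℓ j x ≡ ℓ j z
      xj = near₃ j nxz p≢i (≢-sym p≢j) (≢-sym i≢j) Dp Diz

    -- At opposite corners `z` and `w` differ in `i` and `j`, hence agree in `p`. But `w` differs
    -- from `x` in `q` and `i`, so it agrees with `x` in `p`, where `z` does not.
    corners-agree : ∀ {z w p q} → p ≢ i → p ≢ j → q ≢ i → q ≢ j → p ≢ q →
      Near 3 x w → Near 3 z w → Split p x z → Split q x w → Corner z → OppositeCorner w → ⊥
    corners-agree {z} {w} {p} {q} p≢i p≢j q≢i q≢j p≢q nxw nzw Dpz Dqw (zi , zj) (wj , wi) =
      Dpz (trans (near₃ p nxw q≢i p≢q p≢i Dqw (λ e → Di (trans e (sym wi)))) (sym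
        (near₃ p nzw i≢j p≢i p≢j (λ e → Di (trans zi (trans e (sym wi)))) (λ e → Dj (trans wj (sym (trans zj e)))))))

    -- The corner itself: the vector of `x` with coordinate `j` taken from `y`. It is given
    -- coordinatewise because no single vertex need have this vector.
    center : Fin r → Fin n
    center t with t ≟ j
    ... | yes _ = y
    ... | no  _ = x

    -- Two deviations of `u` from the centre are reduced to deviations in both `i` and `j`, except
    -- when both lie outside `i` and `j`; then `u` would agree with both `x` and `y` in `i`.
    ball : ∀ {z w p q} → p ≢ i → p ≢ j → q ≢ i → q ≢ j → p ≢ q →
      Split p x z → Corner z → Split q x w → Corner w →
      ∀ {u} → Near 3 x u → Near 3 y u → Near 3 z u → Near 3 w u →
      ∀ {s t} → s ≢ t → Split s (center s) u → Split t (center t) u → ⊥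
    ball {z} {w} {p} {q} p≢i p≢j q≢i q≢j p≢q Dpz (zi , zj) Dqw (wi , wj) {u} nxu nyu nzu nwu = noTwo
      where
      notBoth : Split i x u → Split j y u → ⊥
      -- As `u` differs from `z` in `i` and `j`, it agrees with `z` in `p` and so differs from `x`
      -- there. Differing from `x` in `i` and `p`, it agrees with `x` in `q`; but it also agrees
      -- with `w` in `q`, since it differs from `w` in `i` and `j`.
      notBoth Diu Dju = Dqw (trans (near₃ q nxu (≢-sym p≢i) q≢i (≢-sym p≢q) Diu Dpu) (sym
          (near₃ q nwu i≢j q≢i q≢j (λ e → Diu (trans wi e)) (λ e → Dju (trans wj e)))))
        where
        Dpu : Split p x u
        Dpu e = Dpz (trans e (sym (near₃ p nzu i≢j p≢i p≢j (λ e → Diu (trans zi e)) (λ e → Dju (trans zj e)))))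
      atJ : ∀ {t} → t ≢ j → Split j y u → Split t x u → ⊥
      atJ {t} t≢j Dju Dtu with t ≟ i
      ... | yes refl = notBoth Dtu Dju
      -- Differing from `y` in `j` and `t`, `u` agrees with `y` in `i` and so differs from `x`
      -- there.
      ... | no  t≢i  = notBoth (λ e → Di (trans e (sym
              (near₃ i nyu (≢-sym t≢j) i≢j (≢-sym t≢i) Dju (λ e → Dtu (trans (xy-agree t≢i t≢j) e)))))) Dju
      atI : ∀ {t} → t ≢ i → t ≢ j → Split i x u → Split t x u → ⊥
      atI t≢i t≢j Diu Dtu = notBoth Diu (λ e → Dj (trans
        (near₃ j nxu (≢-sym t≢i) (≢-sym i≢j) (≢-sym t≢j) Diu Dtu) (sym e)))
      noTwo : ∀ {s t} → s ≢ t → Split s (center s) u → Split t (center t) u → ⊥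
      noTwo {s} {t} s≢t Ds Dt with s ≟ j | t ≟ j
      ... | yes refl | yes refl = s≢t refl
      ... | yes refl | no t≢j   = atJ t≢j Ds Dt
      ... | no s≢j   | yes refl = atJ s≢j Dt Ds
      ... | no s≢j   | no t≢j with s ≟ i | t ≟ i
      ...   | yes refl | yes refl = s≢t refl
      ...   | yes refl | no t≢i   = atI t≢i t≢j Ds Dt
      ...   | no s≢i   | yes refl = atI s≢i s≢j Dt Ds
      ...   | no s≢i   | no t≢i   = Di (trans (near₃ i nxu s≢t (≢-sym s≢i) (≢-sym t≢i) Ds Dt) (sym
              (near₃ i nyu s≢t (≢-sym s≢i) (≢-sym t≢i)
                (λ e → Ds (trans (xy-agree s≢i s≢j) e)) (λ e → Dt (trans (xy-agree t≢i t≢j) e)))))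

  -- Structure of the typical vertices

  module Structure (a d : ℕ) {{_ : NonZero n}} {{_ : NonZero a}}
                   (few : 5 · a · (5 · a) · ∑ (allFin n) (λ x → # (far? d x)) ≤ n · n) where

    -- With `Q = 5 · a`, the condition `Good` and up to four reference vertices exclude at most
    -- `5 n / Q = n / a` vertices.
    open Typical {Q = 5 · a} (far? d) few

    class : Fin r → Fin n → ℕ
    class i v = # (sameClass? i v)

    NearlySpanning : Set
    NearlySpanning = ∃ λ i → ∃ λ v → a · n ≤ a · class i v + n

    -- After division by `r · a`: the class has at least `(1 - 1/r - 1/a) n` vertices.
    MissesOnePart : Set
    MissesOnePart = ∃ λ i → ∃ λ v → r · (a · n) ≤ r · (a · class i v) + a · n + r · n

    typical-≤′ : ∀ rs → All Good rs → length rs ≤ 4 → (f : Fin n → ℕ) → (∀ z → Ok rs z → 1 ≤ f z) →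
                 a · n ≤ a · ∑ (allFin n) f + n
    typical-≤′ rs grs rs≤4 f h = *-cancelˡ-≤ 5 (begin
      5 · (a · n)                                      ≡⟨ sym (*-assoc 5 a n) ⟩
      5 · a · n                                        ≤⟨ typical-≤ rs grs f h ⟩
      5 · a · ∑ (allFin n) f + suc (length rs) · n     ≤⟨ +-monoʳ-≤ (5 · a · ∑ (allFin n) f) (*-monoˡ-≤ n (s≤s rs≤4)) ⟩
      5 · a · ∑ (allFin n) f + 5 · n                   ≡⟨ factor a (∑ (allFin n) f) n ⟩
      5 · (a · ∑ (allFin n) f + n)                     ∎)
      where
      open ≤-Reasoning
      factor : ∀ a s n → 5 · a · s + 5 · n ≡ 5 · (a · s + n)
      factor = solve-∀

    goodVertex : ∃ Good
    goodVertex with any? good?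
    ... | yes x = x
    -- Without good vertices nothing is typical, and the weight 0 would give `5 · a · n ≤ n`.
    ... | no ¬x = ⊥-elim (<⇒≱ (*-monoˡ-< n 1<Q)
                    (subst (5 · a · n ≤_) (cong₂ _+_ (trans (cong (5 · a ·_) (∑-0 (allFin n))) (*-zeroʳ (5 · a))) refl)
                      (typical-≤ [] [] (λ _ → 0) (λ z ok → ⊥-elim (¬x (z , proj₁ ok))))))
      where
      1<Q : 1 ℕ.< 5 · a
      1<Q = ≤-trans (s≤s (s≤s z≤n)) (m≤m*n 5 a)

    constant : ∀ rs → All Good rs → length rs ≤ 4 → ∀ i v → (∀ u → Ok rs u → ℓ i v ≡ ℓ i u) → NearlySpanning
    constant rs grs rs≤4 i v h = i , v , typical-≤′ rs grs rs≤4 _ (λ u ok → 1≤𝟙 (sameClass? i v u) (h u ok))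

    -- The deviations from the centre are disjoint for different coordinates,
    -- so some coordinate has at most n / r of them.
    inBall : ∀ rs → All Good rs → length rs ≤ 4 → Fin r → (c : Fin r → Fin n) →
      (∀ u → Ok rs u → ∀ s t → s ≢ t → Split s (c s) u → Split t (c t) u → ⊥) → MissesOnePart
    inBall rs grs rs≤4 i₀ c h with any? (λ t → r · # (λ u → ok? rs u ×-dec split? t (c t) u) ≤? n)
    -- Otherwise each of the `r` disjoint deviation sets has more than `n / r` of the `n` vertices;
    -- `i₀` rules out `r = 0`.
    ... | no ¬few = ⊥-elim (<⇒≱ (*-monoʳ-< r {{r≢0}} ≤-refl) (begin
      r · suc n                                    ≡⟨ cong (_· suc n) (sym (∑-allFin-1 r)) ⟩
      ∑ (allFin r) (λ _ → 1) · suc n               ≡⟨ sym (∑-*ʳ (allFin r) (suc n) (λ _ → 1)) ⟩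
      ∑ (allFin r) (λ _ → 1 · suc n)               ≤⟨ ∑-mono (allFin r) (λ t → ≤-trans (≤-reflexive (*-identityˡ (suc n)))
                                                        (≰⇒> (λ le → ¬few (t , le)))) ⟩
      ∑ (allFin r) (λ t → r · ∑ (allFin n) (dev t)) ≡⟨ ∑-*ˡ (allFin r) r _ ⟩
      r · ∑ (allFin r) (λ t → ∑ (allFin n) (dev t)) ≡⟨ cong (r ·_) (∑-swap (allFin r) (allFin n) dev) ⟩
      r · ∑ (allFin n) (λ u → ∑ (allFin r) (λ t → dev t u)) ≤⟨ *-monoʳ-≤ r (∑-mono (allFin n) once) ⟩
      r · ∑ (allFin n) (λ _ → 1)                   ≡⟨ cong (r ·_) (∑-allFin-1 n) ⟩
      r · n                                        ∎))
      where
      open ≤-Reasoning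
      dev : Fin r → Fin n → ℕ
      dev t u = 𝟙 (ok? rs u ×-dec split? t (c t) u)
      r≢0 : NonZero r
      r≢0 = Fin.nonZeroIndex i₀
      once : ∀ u → ∑ (allFin r) (λ t → dev t u) ≤ 1
      once u = #≤1 (λ t → ok? rs u ×-dec split? t (c t) u) λ s t (ok , Ds) (_ , Dt) →
        case s ≟ t of λ where
          (yes eq) → eq
          (no s≢t) → ⊥-elim (h u ok s t s≢t Ds Dt)
    -- The class misses at most `n / r` deviating and `n / a` discarded vertices; multiplied by
    -- `r · a`, these are the terms `a · n` and `r · n`.
    ... | yes (t , le) = t , c t , (begin
      r · (a · n)                            ≤⟨ *-monoʳ-≤ r (typical-≤′ rs grs rs≤4 (λ u → 𝟙 (sameClass? t (c t) u) + dev u) cover) ⟩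
      r · (a · ∑ (allFin n) (λ u → 𝟙 (sameClass? t (c t) u) + dev u) + n)
                                             ≡⟨ cong (λ s → r · (a · s + n)) (∑-+ (allFin n) _ dev) ⟩
      r · (a · (class t (c t) + ∑ (allFin n) dev) + n)
                                             ≡⟨ expand r a (class t (c t)) (∑ (allFin n) dev) n ⟩
      r · (a · class t (c t)) + a · (r · ∑ (allFin n) dev) + r · n
                                             ≤⟨ +-monoˡ-≤ (r · n) (+-monoʳ-≤ (r · (a · class t (c t))) (*-monoʳ-≤ a le)) ⟩
      r · (a · class t (c t)) + a · n + r · n ∎)
      where
      open ≤-Reasoning
      dev : Fin n → ℕ
      dev u = 𝟙 (ok? rs u ×-dec split? t (c t) u)
      expand : ∀ r a b s n → r · (a · (b + s) + n) ≡ r · (a · b) + a · (r · s) + r · n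
      expand = solve-∀
      cover : ∀ u → Ok rs u → 1 ≤ 𝟙 (sameClass? t (c t) u) + dev u
      cover u ok with sameClass? t (c t) u
      ... | yes _ = s≤s z≤n
      ... | no D  = 1≤𝟙 (ok? rs u ×-dec ¬? (no D)) (ok , D)

  module _ (a : ℕ) {{_ : NonZero n}} {{_ : NonZero a}} where

    -- If coordinate `i` is not constant, some `y` differs from `x` in `i` and so agrees with it in
    -- `j`. A typical `u` differing from `x` in `j` agrees with `x` in `i`, hence differs from `y`
    -- in both `i` and `j`, which is too far. So `j` is constant.
    structure₂ : 2 ≤ r → (few : 5 · a · (5 · a) · ∑ (allFin n) (λ x → # (far? 2 x)) ≤ n · n) →
                 Structure.NearlySpanning a 2 few
    structure₂ 2≤r few = go goodVertex
      where
      open Structure a 2 few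
      open Typical {Q = 5 · a} (far? 2) few
      go : ∃ Good → NearlySpanning
      go (x , gx) with fresh [] (≤-trans (s≤s z≤n) 2≤r)
      ... | i , _ with fresh (i ∷ []) 2≤r
      ...   | j , j≢i ∷ [] with any? (λ y → ok? (x ∷ []) y ×-dec split? i x y)
      ...     | no ¬y = constant (x ∷ []) (gx ∷ []) (s≤s z≤n) i x agree
        where
        agree : ∀ u → Ok (x ∷ []) u → ℓ i x ≡ ℓ i u
        agree u ok with sameClass? i x u
        ... | yes eq = eq
        ... | no D   = ⊥-elim (¬y (u , ok , D))
      ...     | yes (y , (gy , nxy ∷ []) , Dy) =
                constant (y ∷ x ∷ []) (gy ∷ gx ∷ []) (s≤s (s≤s z≤n)) j x agree
        where
        agree : ∀ u → Ok (y ∷ x ∷ []) u → ℓ j x ≡ ℓ j u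
        agree u (gu , nyu ∷ nxu ∷ []) with sameClass? j x u
        ... | yes eq = eq
        ... | no Dj  = ⊥-elim (Dj (trans (near₂ nxy (≢-sym j≢i) Dy)
                (near₂ nyu (≢-sym j≢i) (λ e → Dy (trans (near₂ nxu j≢i Dj) (sym e))))))

    structure₃ : 4 ≤ r → (few : 5 · a · (5 · a) · ∑ (allFin n) (λ x → # (far? 3 x)) ≤ n · n) →
                 Structure.NearlySpanning a 3 few ⊎ Structure.MissesOnePart a 3 few
    structure₃ 4≤r few = start goodVertex
      where
      open Structure a 3 few
      open Typical {Q = 5 · a} (far? 3) few

      Result : Set
      Result = NearlySpanning ⊎ MissesOnePart

      orConstant : ∀ rs → All Good rs → length rs ≤ 4 → ∀ p x →
                   (∀ z → Ok rs z → Split p x z → Result) → Result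
      orConstant rs grs rs≤4 p x h with any? (λ z → ok? rs z ×-dec split? p x z)
      ... | yes (z , ok , D) = h z ok D
      ... | no ¬z = inj₁ (constant rs grs rs≤4 p x agree)
        where
        agree : ∀ u → Ok rs u → ℓ p x ≡ ℓ p u
        agree u ok with sameClass? p x u
        ... | yes eq = eq
        ... | no D   = ⊥-elim (¬z (u , ok , D))

      -- Four coordinates leave `p` and `q` besides `i` and `j`. Unless one of these is constant on
      -- the typical vertices, there are witnesses `z` and `w` of deviations from `x`. They lie at
      -- the same corner, which becomes the centre of the ball.
      square : ∀ {x y i j} → Good x → Good y → i ≢ j → Near 3 x y → Split i x y → Split j x y → Result
      square {x} {y} {i} {j} gx gy i≢j nxy Di Dj with fresh (i ∷ j ∷ []) (≤-trans (s≤s (s≤s (s≤s z≤n))) 4≤r)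
      ... | p , p≢i ∷ p≢j ∷ [] with fresh (p ∷ i ∷ j ∷ []) 4≤r
      ...   | q , q≢p ∷ q≢i ∷ q≢j ∷ [] =
        orConstant (y ∷ x ∷ []) (gy ∷ gx ∷ []) (s≤s (s≤s z≤n)) p x λ where
          z (gz , nyz ∷ nxz ∷ []) Dpz →
            orConstant (z ∷ y ∷ x ∷ []) (gz ∷ gy ∷ gx ∷ []) (s≤s (s≤s (s≤s z≤n))) q x λ where
              w (gw , nzw ∷ nyw ∷ nxw ∷ []) Dqw →
                let ball = inBall (w ∷ z ∷ y ∷ x ∷ []) (gw ∷ gz ∷ gy ∷ gx ∷ []) ≤-refl i in
                inj₂ (case S.corner p≢i p≢j nxz nyz Dpz , S.corner q≢i q≢j nxw nyw Dqw of λ where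
                  (inj₁ cz , inj₁ cw) → ball S.center λ where
                    u (_ , nwu ∷ nzu ∷ nyu ∷ nxu ∷ []) s t →
                      S.ball p≢i p≢j q≢i q≢j (≢-sym q≢p) Dpz cz Dqw cw nxu nyu nzu nwu
                  (inj₂ cz , inj₂ cw) → ball S′.center λ where
                    u (_ , nwu ∷ nzu ∷ nyu ∷ nxu ∷ []) s t →
                      S′.ball p≢j p≢i q≢j q≢i (≢-sym q≢p) Dpz cz Dqw cw nxu nyu nzu nwu
                  (inj₁ cz , inj₂ cw) →
                    ⊥-elim (S.corners-agree p≢i p≢j q≢i q≢j (≢-sym q≢p) nxw nzw Dpz Dqw cz cw)
                  (inj₂ cz , inj₁ cw) →
                    ⊥-elim (S′.corners-agree p≢j p≢i q≢j q≢i (≢-sym q≢p) nxw nzw Dpz Dqw cz cw))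
        where
        module S  = Square i≢j nxy Di Dj
        -- Exchanging `i` and `j` turns the opposite corner into the corner.
        module S′ = Square (≢-sym i≢j) nxy Dj Di

      start : ∃ Good → Result
      start (x , gx) with any? (λ y → ok? (x ∷ []) y ×-dec
          any? (λ i → any? (λ j → ¬? (i ≟ j) ×-dec split? i x y ×-dec split? j x y)))
      ... | yes (y , (gy , nxy ∷ []) , i , j , i≢j , Di , Dj) = square gx gy i≢j nxy Di Dj
      ... | no ¬y = inj₂ (inBall (x ∷ []) (gx ∷ []) (s≤s z≤n) (proj₁ (fresh [] (≤-trans (s≤s z≤n) 4≤r))) (λ _ → x)
              λ u ok s t s≢t Ds Dt → ¬y (u , ok , s , t , s≢t , Ds , Dt))

-- Large components in nearly complete hypergraphs

module _ {n r : ℕ} (ℓ : Fin r → Fin n → Fin n) where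
  open Partitions ℓ

  classSet : Fin r → Fin n → Subset n
  classSet i v = Vec.tabulate (λ u → does (sameClass? i v u))

  ∈-classSet : ∀ i v u → u ∈ classSet i v → ℓ i v ≡ ℓ i u
  ∈-classSet i v u u∈ with sameClass? i v u | trans (sym (lookup∘tabulate (λ w → does (sameClass? i v w)) u)) ([]=⇒lookup u∈)
  ... | yes eq | _  = eq
  ... | no _   | ()

∣tabulate∣ : ∀ {n} {P : Fin n → Set} (P? : Decidable P) → ∣ Vec.tabulate (λ u → does (P? u)) ∣ ≡ # P?
∣tabulate∣ {zero}  P? = refl
∣tabulate∣ {suc n} P? rewrite ∑-allFin-suc n (λ x → 𝟙 (P? x)) with P? zero
... | yes _ = cong suc (∣tabulate∣ (P? ∘ suc))
... | no  _ = ∣tabulate∣ (P? ∘ suc)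

-- From colourings to partitions into components

module _ {n r : ℕ} (G : Hypergraph n) (χ : Colouring n r) where

  label : Fin r → Fin n → Fin n
  label i = proj₁ (components G χ i)

  open Partitions label

  -- An edge containing the tuple would put all entries into the class of `x` for its own colour.
  split⇒nonEdge : ∀ {k} x (t : Vec (Fin n) k) → (∀ i → Anyⱽ (Split i x) t) →
    ∀ e → Allⱽ (_∈ e) (x ∷ t) → G e ≡ false
  split⇒nonEdge x t split e (x∈e ∷ t⊆e) with G e in e∈G
  ... | false = refl
  ... | true  = ⊥-elim (clash (split (χ e)) t⊆e)
    where
    clash : ∀ {k} {t : Vec (Fin n) k} → Anyⱽ (Split (χ e) x) t → Allⱽ (_∈ e) t → ⊥
    clash (here D)  (z∈e ∷ _) = D (proj₂ (proj₂ (components G χ (χ e))) x _ (e , e∈G , refl , x∈e , z∈e))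
    clash (there p) (_ ∷ ps)  = clash p ps

  -- The bound `(p/q - 1/a) n` on the size of a class, multiplied out to avoid subtraction.
  Large : ℕ → ℕ → ℕ → Fin r → Fin n → Set
  Large a p q i v = a · (p · n) ≤ q · n + a · (q · # (sameClass? i v))

  module _ (a p q : ℕ) {{_ : NonZero a}} {{_ : NonZero q}} {{_ : NonZero n}} (p≤q : p ≤ q) where

    ¬Large⇒spread : ∀ i x → ¬ Large a p q i x → n ≤ a · # (split? i x)
    ¬Large⇒spread i x ¬large = *-cancelˡ-≤ q (+-cancelʳ-≤ (a · (q · s)) _ _ (begin
      q · n + a · (q · s)             ≤⟨ <⇒≤ (≰⇒> ¬large) ⟩
      a · (p · n)                     ≤⟨ *-monoʳ-≤ a (*-monoˡ-≤ n p≤q) ⟩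
      a · (q · n)                     ≡⟨ cong (λ j → a · (q · j)) (sym (#-complement (sameClass? i x))) ⟩
      a · (q · (s + # (split? i x)))  ≡⟨ expand a q s (# (split? i x)) ⟩
      q · (a · # (split? i x)) + a · (q · s) ∎))
      where
      open ≤-Reasoning
      s = # (sameClass? i x)
      expand : ∀ a q s t → a · (q · (s + t)) ≡ q · (a · t) + a · (q · s)
      expand = solve-∀

    -- Largeness is decidable, so suppose that no class is large. Then every class leaves out at
    -- least `n / a` vertices, and `few-far` together with the scarcity of non-edges supplies the
    -- premise of `fromFew`.
    largeComponent : ∀ d m → r ≤ d + m → 2 + m ≤ n →
      a ^ m · (2 + m) ^ (2 + m) · (5 · a · (5 · a)) · count (nonEdge? G (2 + m)) (allSubsets n) ≤ n ^ (2 + m) →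
      (5 · a · (5 · a) · ∑ (allFin n) (λ x → # (far? d x)) ≤ n · n → ∃ λ i → ∃ λ v → Large a p q i v) →
      Σ (Fin r) λ c → Σ (Fin n) λ v → Σ (Subset n) λ S →
        (∀ u → u ∈ S → Conn G χ c v u) × a · (p · n) ≤ q · n + a · (q · ∣ S ∣)
    largeComponent d m r≤d+m k≤n sparse fromFew = case large of λ (i , v , big) →
      i , v , classSet label i v ,
      (λ u u∈ → proj₁ (proj₂ (components G χ i)) v u (∈-classSet label i v u u∈)) ,
      subst (λ j → a · (p · n) ≤ q · n + a · (q · j)) (sym (∣tabulate∣ (sameClass? i v))) big
      where
      large : ∃ λ i → ∃ λ v → Large a p q i v
      large with any? (λ i → any? (λ v → a · (p · n) ≤? q · n + a · (q · # (sameClass? i v))))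
      ... | yes found = found
      ... | no ¬large = fromFew (*-cancelʳ-≤ _ _ (n ^ m) {{m^n≢0 n m}} (begin
        Q² · F · n ^ m           ≡⟨ *-assoc Q² F _ ⟩
        Q² · (F · n ^ m)         ≤⟨ *-monoʳ-≤ Q² (few-far d m r≤d+m (nonEdgesOver G k)
                                      (λ x t split → 1≤nonEdgesOver G k k≤n (x ∷ t) (split⇒nonEdge x t split))) ⟩
        Q² · (a ^ m · ∑ (tuples n k) (nonEdgesOver G k))
                                 ≤⟨ *-monoʳ-≤ Q² (*-monoʳ-≤ (a ^ m) (∑-nonEdgesOver G k)) ⟩
        Q² · (a ^ m · (k ^ k · N)) ≡⟨ regroup Q² (a ^ m) (k ^ k) N ⟩
        a ^ m · k ^ k · Q² · N   ≤⟨ sparse ⟩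
        n · (n · n ^ m)          ≡⟨ sym (*-assoc n n _) ⟩
        n · n · n ^ m            ∎))
        where
        open ≤-Reasoning
        open Counting a (λ i x → ¬Large⇒spread i x (λ big → ¬large (i , x , big)))
        k  = 2 + m
        Q² = 5 · a · (5 · a)
        F  = ∑ (allFin n) (λ x → # (far? d x))
        N  = count (nonEdge? G k) (allSubsets n)
        regroup : ∀ q b c e → q · (b · (c · e)) ≡ b · c · q · e
        regroup = solve-∀

-- The reciprocal of `ε`. Its factors pay for the choice of splitting vertices, for the tuples
-- inside a non-edge, and for the passage to typical vertices.
complementBound : ℕ → ℕ → ℕ
complementBound a m = a ^ m · (2 + m) ^ (2 + m) · (5 · a · (5 · a))

complementBound≢0 : ∀ a m {{_ : NonZero a}} → NonZero (complementBound a m)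
complementBound≢0 a m = m*n≢0 (a ^ m · (2 + m) ^ (2 + m)) (5 · a · (5 · a))
  {{m*n≢0 (a ^ m) ((2 + m) ^ (2 + m)) {{m^n≢0 a m}} {{m^n≢0 (2 + m) (2 + m)}}}} {{m*n≢0 (5 · a) (5 · a) {{m*n≢0 5 a}} {{m*n≢0 5 a}}}}

SparseComplement : ∀ {n} → ℕ → ℕ → Hypergraph n → Set
SparseComplement {n} a m G =
  complementBound a m · count (nonEdge? G (2 + m)) (allSubsets n) ≤ n ^ (2 + m)

LargeComponent : ∀ {n r} → Hypergraph n → Colouring n r → ℕ → ℕ → ℕ → Set
LargeComponent {n} {r} G χ a p q = Σ (Fin r) λ c → Σ (Fin n) λ v → Σ (Subset n) λ S →
  (∀ u → u ∈ S → Conn G χ c v u) × a · (p · n) ≤ q · n + a · (q · ∣ S ∣)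

k-colours : ∀ {n} a m {{_ : NonZero a}} {{_ : NonZero n}} (G : Hypergraph n) (χ : Colouring n (2 + m)) →
  2 + m ≤ n → SparseComplement a m G → LargeComponent G χ a 1 1
k-colours {n} a m G χ k≤n sparse = largeComponent G χ a 1 1 ≤-refl 2 m ≤-refl k≤n sparse λ few →
  case structure₂ a (s≤s (s≤s z≤n)) few of λ (i , v , spanning) → i , v , (begin
    a · (1 · n)                               ≡⟨ cong (a ·_) (*-identityˡ n) ⟩
    a · n                                     ≤⟨ spanning ⟩
    a · # (sameClass? i v) + n                ≡⟨ units a (# (sameClass? i v)) n ⟩
    1 · n + a · (1 · # (sameClass? i v))      ∎)
  where
  open ≤-Reasoning
  open Partitions (label G χ)
  units : ∀ a s n → a · s + n ≡ 1 · n + a · (1 · s)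
  units = solve-∀

-- The premise `1 ≤ m` provides the four coordinates for `structure₃`. A nearly spanning class is
-- more than enough; in the other case cancelling `a · n` turns `1 - 1/(k+1)` into `k/(k+1)`.
k+1-colours : ∀ {n} a m {{_ : NonZero a}} {{_ : NonZero n}} (G : Hypergraph n) (χ : Colouring n (3 + m)) →
  1 ≤ m → 2 + m ≤ n → SparseComplement a m G → LargeComponent G χ a (2 + m) (3 + m)
k+1-colours {n} a m G χ 1≤m k≤n sparse = largeComponent G χ a k (suc k) (n≤1+n k) 3 m ≤-refl k≤n sparse λ few →
  case structure₃ a (s≤s (s≤s (s≤s 1≤m))) few of λ where
    (inj₁ (i , v , spanning)) → i , v , (begin
      a · (k · n)                                   ≡⟨ swap a k n ⟩
      k · (a · n)                                   ≤⟨ *-monoʳ-≤ k spanning ⟩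
      k · (a · # (sameClass? i v) + n)              ≤⟨ *-monoˡ-≤ (a · # (sameClass? i v) + n) (n≤1+n k) ⟩
      suc k · (a · # (sameClass? i v) + n)          ≡⟨ expand (suc k) a (# (sameClass? i v)) n ⟩
      suc k · n + a · (suc k · # (sameClass? i v))  ∎)
    (inj₂ (i , v , missing)) → i , v , +-cancelˡ-≤ (a · n) _ _ (begin
      a · n + a · (k · n)                                     ≡⟨ cong₂ _+_ (refl {x = a · n}) (swap a k n) ⟩
      suc k · (a · n)                                         ≤⟨ missing ⟩
      suc k · (a · # (sameClass? i v)) + a · n + suc k · n    ≡⟨ rearrange (suc k) a (# (sameClass? i v)) n ⟩
      a · n + (suc k · n + a · (suc k · # (sameClass? i v)))  ∎)
  where
  open ≤-Reasoning
  open Partitions (label G χ)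
  k = 2 + m
  swap : ∀ a k n → a · (k · n) ≡ k · (a · n)
  swap = solve-∀
  expand : ∀ r a s n → r · (a · s + n) ≡ r · n + a · (r · s)
  expand = solve-∀
  rearrange : ∀ r a s n → r · (a · s) + a · n + r · n ≡ a · n + (r · n + a · (r · s))
  rearrange = solve-∀

-- Rational bounds as inequalities between natural numbers

module _ (p q₋₁ a₋₁ n s : ℕ) where
  private
    q = suc q₋₁
    a = suc a₋₁

    valueᵘ : ℚᵘ.ℚᵘ
    valueᵘ = (ℚᵘ.mkℚᵘ (+ p) q₋₁ ℚᵘ.- ℚᵘ.mkℚᵘ (+ 1) a₋₁) ℚᵘ.* ℚᵘ.mkℚᵘ (+ n) 0

    toℚᵘ-/ : ∀ i d → ℚ.toℚᵘ (i / suc d) ℚᵘ.≃ ℚᵘ.mkℚᵘ i d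
    toℚᵘ-/ i d = ℚ.toℚᵘ-fromℚᵘ (ℚᵘ.mkℚᵘ i d)

    value : ℚ.toℚᵘ (((+ p) / q - (+ 1) / a) * ℕtoℚ n) ℚᵘ.≃ valueᵘ
    value = ℚᵘ.≃-trans (ℚ.toℚᵘ-homo-* ((+ p) / q - (+ 1) / a) (ℕtoℚ n)) (ℚᵘ.*-cong
      (ℚᵘ.≃-trans (ℚ.toℚᵘ-homo-+ ((+ p) / q) (ℚ.- ((+ 1) / a))) (ℚᵘ.+-cong (toℚᵘ-/ (+ p) q₋₁)
        (ℚᵘ.≃-trans (ℚ.toℚᵘ-homo‿- ((+ 1) / a)) (ℚᵘ.-‿cong (toℚᵘ-/ (+ 1) a₋₁)))))
      (toℚᵘ-/ (+ n) 0))

    numerator≡ : ℚᵘ.↥ valueᵘ ℤ.* + 1 ≡ + (a · (p · n)) ℤ.- + (q · n)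
    numerator≡ = trans (ring (+ p) (+ q) (+ a) (+ n)) (cong₂ ℤ._-_
      (trans (cong (+ a ℤ.*_) (sym (ℤ.pos-* p n))) (sym (ℤ.pos-* a (p · n)))) (sym (ℤ.pos-* q n)))
      where
      ring : ∀ p q a n → ((p ℤ.* a ℤ.+ (ℤ.- + 1) ℤ.* q) ℤ.* n) ℤ.* + 1 ≡ a ℤ.* (p ℤ.* n) ℤ.- q ℤ.* n
      ring = ℤ-Ring.solve-∀

    denominator≡ : + s ℤ.* ℚᵘ.↧ valueᵘ ≡ + (q · n + a · (q · s)) ℤ.- + (q · n)
    denominator≡ = trans (sym (ℤ.pos-* s (q · a · 1))) (trans (cong +_ (units q a s))
      (sym (trans (cong (ℤ._- + (q · n)) (ℤ.pos-+ (q · n) (a · (q · s)))) (ring (+ (q · n)) (+ (a · (q · s)))))))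
      where
      units : ∀ q a s → s · (q · a · 1) ≡ a · (q · s)
      units = solve-∀
      ring : ∀ i j → (i ℤ.+ j) ℤ.- i ≡ j
      ring = ℤ-Ring.solve-∀

  -- Over the denominator `q · a`, and with `q · n` added to both numerators, the two inequalities
  -- coincide.
  ≤⇒value≤ : a · (p · n) ≤ q · n + a · (q · s) → ((+ p) / q - (+ 1) / a) * ℕtoℚ n ℚ.≤ ℕtoℚ s
  ≤⇒value≤ h = ℚ.toℚᵘ-cancel-≤ (ℚᵘ.≤-respˡ-≃ (ℚᵘ.≃-sym value) (ℚᵘ.≤-respʳ-≃ (ℚᵘ.≃-sym (toℚᵘ-/ (+ s) 0))
    (ℚᵘ.*≤* (subst₂ ℤ._≤_ (sym numerator≡) (sym denominator≡) (ℤ.+-monoˡ-≤ (ℤ.- + (q · n)) (ℤ.+≤+ h))))))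

  ≥⇒value≥ : q · n + a · (q · s) ≤ a · (p · n) → ℕtoℚ s ℚ.≤ ((+ p) / q - (+ 1) / a) * ℕtoℚ n
  ≥⇒value≥ h = ℚ.toℚᵘ-cancel-≤ (ℚᵘ.≤-respʳ-≃ (ℚᵘ.≃-sym value) (ℚᵘ.≤-respˡ-≃ (ℚᵘ.≃-sym (toℚᵘ-/ (+ s) 0))
    (ℚᵘ.*≤* (subst₂ ℤ._≤_ (sym denominator≡) (sym numerator≡) (ℤ.+-monoˡ-≤ (ℤ.- + (q · n)) (ℤ.+≤+ h))))))

1/a≤α⇒≤ : ∀ {α} p q₋₁ a₋₁ n s → (+ 1) / suc a₋₁ ℚ.≤ α →
  suc a₋₁ · (p · n) ≤ suc q₋₁ · n + suc a₋₁ · (suc q₋₁ · s) → ((+ p) / suc q₋₁ - α) * ℕtoℚ n ℚ.≤ ℕtoℚ s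
1/a≤α⇒≤ {α} p q₋₁ a₋₁ n s 1/a≤α h = ℚ.≤-trans
  (ℚ.*-monoʳ-≤-nonNeg (ℕtoℚ n) {{ℚ.normalize-nonNeg n 1}}
    (ℚ.+-monoʳ-≤ ((+ p) / suc q₋₁) (ℚ.neg-antimono-≤ 1/a≤α)))
  (≤⇒value≤ p q₋₁ a₋₁ n s h)

reciprocal≤ : ∀ α → 0ℚ < α → ∃ λ a₋₁ → (+ 1) / suc a₋₁ ℚ.≤ α
reciprocal≤ (ℚ.mkℚ (+ zero)     d _) (ℚ.*<* (ℤ.+<+ ()))
reciprocal≤ (ℚ.mkℚ ℤ.-[1+ _ ]   d _) (ℚ.*<* ())
-- The numerator of a positive `α` is at least 1, so the reciprocal of its denominator suffices.
reciprocal≤ α@(ℚ.mkℚ (+ suc i) d _) _ = d , ℚ.toℚᵘ-cancel-≤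
  (ℚᵘ.≤-respˡ-≃ (ℚᵘ.≃-sym (ℚ.toℚᵘ-fromℚᵘ (ℚᵘ.mkℚᵘ (+ 1) d)))
    (ℚᵘ.*≤* (ℤ.*-monoʳ-≤-nonNeg (+ suc d) (ℤ.+≤+ (s≤s (z≤n {i}))))))

-- Density means `E · edgeCount G + n C k > E · (n C k)`. Writing the right side as `E` times edges
-- plus non-edges and cancelling the edges leaves at most `n C k ≤ n ^ k`.
dense⇒sparseComplement : ∀ {n} E {{_ : NonZero E}} k (G : Hypergraph n) → Uniform k G →
  (1ℚ - (+ 1) / E) * ℕtoℚ (n C k) < ℕtoℚ (edgeCount G) →
  E · count (nonEdge? G k) (allSubsets n) ≤ n ^ k
dense⇒sparseComplement {n} E@(suc E₋₁) k G uniform dense = ≤-trans (+-cancelˡ-≤ (E · edgeCount G) _ _ (begin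
  E · edgeCount G + E · N                      ≡⟨ sym (*-distribˡ-+ E _ N) ⟩
  E · (edgeCount G + N)                        ≡⟨ cong (E ·_) (edges+nonEdges G k uniform) ⟩
  E · (n C k)                                  ≤⟨ <⇒≤ (≰⇒> tooFew) ⟩
  E · edgeCount G + n C k                      ∎)) (nCk≤n^k n k)
  where
  open ≤-Reasoning
  N = count (nonEdge? G k) (allSubsets n)
  units : ∀ E c e → 1 · c + E · (1 · e) ≡ E · e + c
  units = solve-∀
  tooFew : ¬ (E · edgeCount G + n C k ≤ E · (n C k))
  tooFew h = ℚ.<-irrefl refl (ℚ.<-≤-trans dense (≥⇒value≥ 1 0 E₋₁ (n C k) (edgeCount G)
    (subst₂ _≤_ (sym (units E (n C k) (edgeCount G))) (sym (cong (E ·_) (*-identityˡ (n C k)))) h)))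

theorem1p3 : (α : ℚ) → 0ℚ < α → (k : ℕ) → k ≥ 3 →
    Σ ℚ λ ε → 0ℚ < ε × Σ ℕ λ n₀ →
    ∀ (n : ℕ) → n ≥ n₀ → (G : Hypergraph n) → Uniform k G →
    (1ℚ - ε) * ℕtoℚ (n C k) < ℕtoℚ (edgeCount G) →
    MCAtLeast k G ((1ℚ - α) * ℕtoℚ n)
    × MCAtLeast (suc k) G (((+ k) / suc k - α) * ℕtoℚ n)
theorem1p3 α 0<α k@(suc (suc m)) (s≤s (s≤s 1≤m)) =
  let a₋₁ , 1/a≤α = reciprocal≤ α 0<α
      a = suc a₋₁
      E = complementBound a m
      instance E≢0 : NonZero E
               E≢0 = complementBound≢0 a m
  -- The threshold `n₀ = k` lets every tuple be completed to a set of size `k` and makes `n`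
  -- nonzero.
  in (+ 1) / E , ℚ.positive⁻¹ ((+ 1) / E) {{ℚ.normalize-pos 1 E}} , k , λ n n≥k G uniform dense →
  let instance n≢0 : NonZero n
               n≢0 = >-nonZero (≤-trans (s≤s z≤n) n≥k)
      sparse : SparseComplement a m G
      sparse = dense⇒sparseComplement E k G uniform dense
  in (λ χ → case k-colours a m G χ n≥k sparse of λ (c , v , S , conn , large) →
       c , v , S , conn , 1/a≤α⇒≤ 1 0 a₋₁ n ∣ S ∣ 1/a≤α large)
   , (λ χ → case k+1-colours a m G χ 1≤m n≥k sparse of λ (c , v , S , conn , large) →
       c , v , S , conn , 1/a≤α⇒≤ k k a₋₁ n ∣ S ∣ 1/a≤α large)
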